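{- Let $\mathsf{L}$, $\mathsf{L}'$, $\mathsf{H}$, $\mathsf{H}'$ be simplicial complexes. If $\mathsf{L}'$ is isomorphic to $\mathsf{L}$ and $\mathsf{H}'$ is isomorphic to $\mathsf{H}$, then $$\mathrm{C}(\mathsf{L};\mathsf{H})=\mathrm{C}(\mathsf{L}';\mathsf{H}')\quad\text{and}\quad \mathrm{IC}(\mathsf{L};\mathsf{H})=\mathrm{IC}(\mathsf{L}';\mathsf{H}').$$
   Context: A simplicial complex is an abstract simplicial complex: a set $\mathsf{K}$ of subsets (simplices) of a vertex set $V(\mathsf{K})=\bigcup\mathsf{K}$ such that $F\in\mathsf{K}$ and $G\subseteq F$ imply $G\in\mathsf{K}$. A facet is a simplex that is maximal with respect to inclusion; a facet is non-unitary if it has at least two vertices. A subcomplex of $\mathsf{K}$ is a simplicial complex contained in $\mathsf{K}$. The union of simplicial complexes is the union of their vertex sets and of their sets of simplices. A simplicial map $f:\mathsf{L}\to\mathsf{K}$ is a map $f:V(\mathsf{L})\to V(\mathsf{K})$ such that $f(F)\in\mathsf{K}$ whenever $F\in\mathsf{L}$; it is injective (bijective) if it is injective (bijective) on vertices. An isomorphism is a bijective simplicial map whose inverse is also a simplicial map. A facet simplicial map is a simplicial map $f:\mathsf{L}\to\mathsf{K}$ such that $f(F)$ is a non-unitary facet of $\mathsf{K}$ whenever $F$ is a non-unitary facet of $\mathsf{L}$. The facet-complexity $\mathrm{C}(\mathsf{L};\mathsf{K})$ is the least positive integer $k$ such that there exist subcomplexes $\mathsf{L}_1,\ldots,\mathsf{L}_k$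 of $\mathsf{L}$ with $\mathsf{L}=\mathsf{L}_1\cup\cdots\cup\mathsf{L}_k$ and, for each $i$, a facet simplicial map $f_i:\mathsf{L}_i\to\mathsf{K}$; it is $\infty$ if no such $k$ exists. The injective facet-complexity $\mathrm{IC}(\mathsf{L};\mathsf{K})$ is defined in the same way, requiring each $f_i$ to be an injective facet simplicial map. -}

module Defs where

open import Data.Fin.Base using (Fin)
open import Data.Nat.Base using (ℕ; _≤_; _<_)
open import Data.Nat.Induction using (<-rec)
open import Data.Nat.Properties using (≤-antisym; ≮⇒≥)
open import Data.Product using (Σ; ∃; ∃₂; _×_; _,_; proj₁; proj₂)
open import Function.Bundles using (Func)
open import Function.Definitions using (Injective; Bijective; Inverseᵇ)
open import Level using (Level; suc)
open import Relation.Binary.Bundles using (Setoid)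
open import Relation.Binary.PropositionalEquality as ≡ using (_≡_; _≢_; refl; cong)
open import Relation.Nullary using (¬_; contradiction)
open import Relation.Nullary.Construct.Add.Supremum using (_⁺; [_]; ⊤⁺)
open import Relation.Unary using (Pred; _∈_; _⊆_; _≐_)
import Relation.Binary.Construct.On as On

private
  variable
    ℓ p : Level
    U W : Set ℓ

-- The type U is only an ambient universe in which the vertices live; the vertex
-- set is the union of the simplices (`vertices` below) and may be smaller.
-- This lets a complex and its subcomplexes share U.  Subsets are predicates,
-- compared extensionally; `downward` makes `simplices` respect that equality.
record SimplicialComplex {ℓ} (U : Set ℓ) : Set (suc ℓ) where
  field
    simplices : Pred (Pred U ℓ) ℓ
    downward  : ∀ {F G} → F ∈ simplices → G ⊆ F → G ∈ simplices

open SimplicialComplex public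

vertices : ∀ {ℓ} {U : Set ℓ} → SimplicialComplex U → Pred U (suc ℓ)
vertices {ℓ} {U} K v = ∃ λ (F : Pred U ℓ) → F ∈ simplices K × v ∈ F

-- Vertices are equal when the underlying elements of U are, whichever simplices
-- witness that they are vertices.
V : ∀ {ℓ} {U : Set ℓ} → SimplicialComplex U → Setoid (suc ℓ) ℓ
V {U = U} K = On.setoid {B = Σ U (vertices K)} (≡.setoid U) proj₁

_⊑_ : SimplicialComplex {ℓ} U → SimplicialComplex U → Set (suc ℓ)
K₁ ⊑ K = simplices K₁ ⊆ simplices K

-- The vertex set of the union is automatically the union of the vertex sets.
⋃ : ∀ {k} → (Fin k → SimplicialComplex {ℓ} U) → SimplicialComplex U
⋃ Ks .simplices F = ∃ λ i → F ∈ simplices (Ks i)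
⋃ Ks .downward (i , F∈Kᵢ) G⊆F = i , downward (Ks i) F∈Kᵢ G⊆F

Facet : SimplicialComplex {ℓ} U → Pred (Pred U ℓ) (suc ℓ)
Facet K F = F ∈ simplices K × (∀ {G} → G ∈ simplices K → F ⊆ G → G ⊆ F)

NonUnitaryFacet : SimplicialComplex {ℓ} U → Pred (Pred U ℓ) (suc ℓ)
NonUnitaryFacet K F = Facet K F × (∃₂ λ v w → v ∈ F × w ∈ F × v ≢ w)

module _ {ℓ} {U W : Set ℓ} {L : SimplicialComplex U} {K : SimplicialComplex W}
         (f : Func (V L) (V K)) where

  open Func f using (to)

  -- f(F).  The simplex F itself witnesses that its elements are vertices of L.
  image : ∀ {F} → F ∈ simplices L → Pred W ℓ
  image {F} F∈L w = ∃₂ λ v (v∈F : v ∈ F) → proj₁ (to (v , F , F∈L , v∈F)) ≡ w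

  IsSimplicial : Set (suc ℓ)
  IsSimplicial = ∀ {F} (F∈L : F ∈ simplices L) → image F∈L ∈ simplices K

  IsFacetSimplicial : Set (suc ℓ)
  IsFacetSimplicial = IsSimplicial ×
    (∀ {F} (F∈L : F ∈ simplices L) → NonUnitaryFacet L F → NonUnitaryFacet K (image F∈L))

  IsInjective : Set (suc ℓ)
  IsInjective = Injective (Setoid._≈_ (V L)) (Setoid._≈_ (V K)) to

  IsBijective : Set (suc ℓ)
  IsBijective = Bijective (Setoid._≈_ (V L)) (Setoid._≈_ (V K)) to

infix 4 _≅_ _⊑_

record _≅_ {ℓ} {U W : Set ℓ} (L : SimplicialComplex U) (K : SimplicialComplex W) : Set (suc ℓ) where
  field
    map                : Func (V L) (V K)
    map-simplicial     : IsSimplicial {L = L} {K = K} map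
    map-bijective      : IsBijective {L = L} {K = K} map
    inverse            : Func (V K) (V L)
    isInverse          : Inverseᵇ (Setoid._≈_ (V L)) (Setoid._≈_ (V K)) (Func.to map) (Func.to inverse)
    inverse-simplicial : IsSimplicial {L = K} {K = L} inverse

FacetMap : ∀ {ℓ} {U W : Set ℓ} → SimplicialComplex U → SimplicialComplex W → Set (suc ℓ)
FacetMap L K = ∃ λ (f : Func (V L) (V K)) → IsFacetSimplicial {L = L} {K = K} f

InjectiveFacetMap : ∀ {ℓ} {U W : Set ℓ} → SimplicialComplex U → SimplicialComplex W → Set (suc ℓ)
InjectiveFacetMap L K = ∃ λ (f : Func (V L) (V K)) →
  IsFacetSimplicial {L = L} {K = K} f × IsInjective {L = L} {K = K} f

-- L is the union of k subcomplexes, each of which satisfies P.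
CoveredBy : ∀ {ℓ} {U : Set ℓ} → Pred (SimplicialComplex U) (suc ℓ) →
            SimplicialComplex U → ℕ → Set (suc ℓ)
CoveredBy {U = U} P L k = ∃ λ (Ls : Fin k → SimplicialComplex U) →
  (∀ i → Ls i ⊑ L) × simplices L ≐ simplices (⋃ Ls) × (∀ i → P (Ls i))

-- `LeastPositive P c` says that c ∈ ℕ ∪ {∞} is the least positive integer
-- satisfying P, with c = ∞ if there is none.  It is the graph of the minimum:
-- constructively the minimum of an undecidable P cannot be computed, but its
-- value is unique, and it is contradictory for there to be none.
LeastPositive : Pred ℕ p → Pred (ℕ ⁺) p
LeastPositive P [ k ] = 0 < k × P k × (∀ {j} → 0 < j → P j → k ≤ j)
LeastPositive P ⊤⁺    = ∀ {k} → 0 < k → ¬ P k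

LeastPositive-unique : ∀ {P : Pred ℕ p} {c d} → LeastPositive P c → LeastPositive P d → c ≡ d
LeastPositive-unique {c = [ _ ]} {[ _ ]} (0<c , Pc , c≤) (0<d , Pd , d≤) =
  cong [_] (≤-antisym (c≤ 0<d Pd) (d≤ 0<c Pc))
LeastPositive-unique {c = [ _ ]} {⊤⁺} (0<c , Pc , _) none = contradiction Pc (none 0<c)
LeastPositive-unique {c = ⊤⁺} {[ _ ]} none (0<d , Pd , _) = contradiction Pd (none 0<d)
LeastPositive-unique {c = ⊤⁺} {⊤⁺} _ _ = refl

LeastPositive-¬¬exists : (P : Pred ℕ p) → ¬ ¬ (∃ λ c → LeastPositive P c)
LeastPositive-¬¬exists P ∄c = ∄c (⊤⁺ , λ {k} → none k)
  where
  none : ∀ k → 0 < k → ¬ P k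
  none = <-rec _ λ k rec 0<k Pk →
    ∄c ([ k ] , 0<k , Pk , λ 0<j Pj → ≮⇒≥ λ j<k → rec j<k 0<j Pj)

-- `C[ L ﹔ K ]= c` reads C(L;K) = c, and `IC[ L ﹔ K ]= c` reads IC(L;K) = c.
C[_﹔_]=_ : ∀ {ℓ} {U W : Set ℓ} → SimplicialComplex U → SimplicialComplex W → Pred (ℕ ⁺) (suc ℓ)
C[ L ﹔ K ]= c = LeastPositive (CoveredBy (λ Lᵢ → FacetMap Lᵢ K) L) c

IC[_﹔_]=_ : ∀ {ℓ} {U W : Set ℓ} → SimplicialComplex U → SimplicialComplex W → Pred (ℕ ⁺) (suc ℓ)
IC[ L ﹔ K ]= c = LeastPositive (CoveredBy (λ Lᵢ → InjectiveFacetMap Lᵢ K) L) c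

{-# OPTIONS --safe #-}
-- Isomorphisms, and their inverses, are injective facet simplicial maps, and
-- such maps compose.  A cover of L pulls back along L′ ≅ L to a cover of L′
-- whose members are isomorphic to the original ones, so conjugating each fᵢ by
-- isomorphisms turns a cover counted by C(L;H) into one counted by C(L′;H′).
module Submission where

open import Defs
open import Data.Nat.Base using (ℕ)
open import Data.Product using (∃; _×_; _,_; proj₁; proj₂; swap)
open import Function.Bundles using (Func; _⇔_; mk⇔)
import Function.Construct.Composition as Composition
open import Function.Consequences.Setoid using (inverseᵇ⇒bijective)
open import Function.Definitions using (Inverseᵇ)
open import Level using (Level)
open import Relation.Binary.Bundles using (Setoid)
open import Relation.Binary.PropositionalEquality using (refl; sym; subst)
open import Relation.Nullary.Construct.Add.Supremum using (_⁺; [_]; ⊤⁺)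
open import Relation.Unary using (Pred; _∈_; _⊆_; _≐_)

open Func using (to)

private
  variable
    ℓ p : Level
    U U′ W W′ X : Set ℓ

Facet-resp-≐ : (K : SimplicialComplex {ℓ} U) {F G : Pred U ℓ} → F ≐ G → Facet K F → Facet K G
Facet-resp-≐ K (F⊆G , G⊆F) (F∈K , maximal) =
  downward K F∈K G⊆F , λ H∈K G⊆H w∈H → F⊆G (maximal H∈K (λ v∈F → G⊆H (F⊆G v∈F)) w∈H)

NonUnitaryFacet-resp-≐ : (K : SimplicialComplex {ℓ} U) {F G : Pred U ℓ} → F ≐ G →
                         NonUnitaryFacet K F → NonUnitaryFacet K G
NonUnitaryFacet-resp-≐ K F≐G@(F⊆G , _) (facet , v , w , v∈F , w∈F , v≢w) =
  Facet-resp-≐ K F≐G facet , v , w , F⊆G v∈F , F⊆G w∈F , v≢w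

image-mono : {L : SimplicialComplex {ℓ} U} {K : SimplicialComplex {ℓ} W} (f : Func (V L) (V K)) {F G : Pred U ℓ}
             (F∈L : F ∈ simplices L) (G∈L : G ∈ simplices L) → F ⊆ G →
             image {L = L} {K = K} f F∈L ⊆ image {L = L} {K = K} f G∈L
-- The two images reach `v` through different simplices, `F` and `G`. Equality of vertices ignores
-- these witnesses, so congruence of `f` identifies the values.
image-mono f F∈L G∈L F⊆G (v , v∈F , refl) = v , F⊆G v∈F , Func.cong f refl

module _ {L : SimplicialComplex {ℓ} U} {K : SimplicialComplex {ℓ} W} {M : SimplicialComplex {ℓ} X}
         (f : Func (V L) (V K)) (g : Func (V K) (V M)) where

  private
    g∘f : Func (V L) (V M)
    g∘f = Composition.function f g

  -- On the left `g` receives the vertex f(v) with f(F) as its simplex, on the right with whichever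
  -- simplex `f` returned; congruence of `g` makes the values agree.
  image-∘ : ∀ {F} (F∈L : F ∈ simplices L) (fF∈K : image {L = L} {K = K} f F∈L ∈ simplices K) →
            image {L = K} {K = M} g fF∈K ≐ image {L = L} {K = M} g∘f F∈L
  image-∘ F∈L fF∈K =
    (λ { (_ , (v , v∈F , refl) , refl) → v , v∈F , Func.cong g refl }) ,
    (λ { (v , v∈F , refl) → _ , (v , v∈F , refl) , Func.cong g refl })

  isFacetSimplicial-∘ : IsFacetSimplicial {L = L} {K = K} f → IsFacetSimplicial {L = K} {K = M} g →
                        IsFacetSimplicial {L = L} {K = M} g∘f
  isFacetSimplicial-∘ (f-simp , f-facet) (g-simp , g-facet) =
    (λ F∈L → downward M (g-simp (f-simp F∈L)) (proj₂ (image-∘ F∈L (f-simp F∈L)))) ,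
    (λ F∈L F-facet → NonUnitaryFacet-resp-≐ M (image-∘ F∈L (f-simp F∈L))
      (g-facet (f-simp F∈L) (f-facet F∈L F-facet)))

FacetMap-trans : (L : SimplicialComplex {ℓ} U) (K : SimplicialComplex {ℓ} W) (M : SimplicialComplex {ℓ} X) →
                 FacetMap L K → FacetMap K M → FacetMap L M
FacetMap-trans L K M (f , f-facet) (g , g-facet) =
  Composition.function f g , isFacetSimplicial-∘ {L = L} {K} {M} f g f-facet g-facet

InjectiveFacetMap-trans : (L : SimplicialComplex {ℓ} U) (K : SimplicialComplex {ℓ} W) (M : SimplicialComplex {ℓ} X) →
                          InjectiveFacetMap L K → InjectiveFacetMap K M → InjectiveFacetMap L M
InjectiveFacetMap-trans L K M (f , f-facet , f-inj) (g , g-facet , g-inj) =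
  Composition.function f g , isFacetSimplicial-∘ {L = L} {K} {M} f g f-facet g-facet , λ eq → f-inj (g-inj eq)

inverseᵇ⇒≅ : {L : SimplicialComplex {ℓ} U} {K : SimplicialComplex {ℓ} W}
             (f : Func (V L) (V K)) (g : Func (V K) (V L)) →
             Inverseᵇ (Setoid._≈_ (V L)) (Setoid._≈_ (V K)) (to f) (to g) →
             IsSimplicial {L = L} {K = K} f → IsSimplicial {L = K} {K = L} g → L ≅ K
inverseᵇ⇒≅ {L = L} {K} f g inv f-simp g-simp = record
  { map                = f
  ; map-simplicial     = f-simp
  ; map-bijective      = inverseᵇ⇒bijective (V L) (V K) {to f} {to g} inv
  ; inverse            = g
  ; isInverse          = inv
  ; inverse-simplicial = g-simp
  }

≅-sym : {L : SimplicialComplex {ℓ} U} {K : SimplicialComplex {ℓ} W} → L ≅ K → K ≅ L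
≅-sym e = inverseᵇ⇒≅ inverse map (swap isInverse) inverse-simplicial map-simplicial
  where open _≅_ e

module _ {L : SimplicialComplex {ℓ} U} {K : SimplicialComplex {ℓ} W} (e : L ≅ K) where

  open _≅_ e

  -- Write f for `map` and g for `inverse`: f(g(w)) = w on vertices. Downward closure turns this
  -- inclusion into membership of f(g(G)) in any complex containing `G`.
  image-inverse-image : ∀ {G} (G∈K : G ∈ simplices K) (gG∈L : image {L = K} {K = L} inverse G∈K ∈ simplices L) →
                        image {L = L} {K = K} map gG∈L ⊆ G
  image-inverse-image {G} G∈K gG∈L (_ , (w , w∈G , refl) , refl) =
    subst G (sym (proj₁ isInverse {x = w , G , G∈K , w∈G} refl)) w∈G

  -- Maximality is carried over by going back through g: if f(F) ⊆ G then F ⊆ g(G), so g(G) ⊆ F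
  -- because `F` is a facet, and applying f gives G ⊆ f(F). Injectivity keeps two distinct vertices
  -- distinct.
  map-isFacetSimplicial : IsFacetSimplicial {L = L} {K = K} map
  map-isFacetSimplicial = map-simplicial , nonUnitary
    where
    maximal : ∀ {F} (F∈L : F ∈ simplices L) → Facet L F → ∀ {G} → G ∈ simplices K →
              image {L = L} {K = K} map F∈L ⊆ G → G ⊆ image {L = L} {K = K} map F∈L
    maximal {F} F∈L (_ , F-max) {G} G∈K fF⊆G {w} w∈G =
      _ , F-max (inverse-simplicial G∈K) F⊆gG (w , w∈G , refl) , proj₁ isInverse refl
      where
      F⊆gG : F ⊆ image {L = K} {K = L} inverse G∈K
      F⊆gG {v} v∈F = _ , fF⊆G (v , v∈F , refl) , proj₂ isInverse {x = v , F , F∈L , v∈F} refl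

    nonUnitary : ∀ {F} (F∈L : F ∈ simplices L) → NonUnitaryFacet L F →
                 NonUnitaryFacet K (image {L = L} {K = K} map F∈L)
    nonUnitary F∈L (facet , v , w , v∈F , w∈F , v≢w) =
      (map-simplicial F∈L , maximal F∈L facet) ,
      _ , _ , (v , v∈F , refl) , (w , w∈F , refl) , λ eq → v≢w (proj₁ map-bijective eq)

  ≅⇒InjectiveFacetMap : InjectiveFacetMap L K
  ≅⇒InjectiveFacetMap = map , map-isFacetSimplicial , proj₁ map-bijective

  ≅⇒FacetMap : FacetMap L K
  ≅⇒FacetMap = map , map-isFacetSimplicial

  -- The proof of F ∈ L is stored because `image` is defined only on simplices; it also makes the
  -- result a subcomplex of `L`.
  pullback : SimplicialComplex {ℓ} W → SimplicialComplex {ℓ} U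
  pullback M .simplices F = ∃ λ (F∈L : F ∈ simplices L) → image {L = L} {K = K} map F∈L ∈ simplices M
  pullback M .downward (F∈L , fF∈M) G⊆F =
    downward L F∈L G⊆F ,
    downward M fF∈M (image-mono {L = L} {K = K} map (downward L F∈L G⊆F) F∈L G⊆F)

  pullback-≅ : (M : SimplicialComplex {ℓ} W) → M ⊑ K → pullback M ≅ M
  -- `f` and `g` restrict `map` and `inverse`: the underlying values are unchanged and only the
  -- simplices witnessing vertices are replaced, so the inverse laws carry over directly.
  pullback-≅ M M⊑K = inverseᵇ⇒≅ f g (proj₁ isInverse , proj₂ isInverse) f-simplicial g-simplicial
    where
    f : Func (V (pullback M)) (V M)
    f .to (v , F , (F∈L , fF∈M) , v∈F) = _ , _ , fF∈M , (v , v∈F , refl)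
    f .Func.cong = Func.cong map

    gG∈pullback : ∀ {G} (G∈M : G ∈ simplices M) →
                  image {L = K} {K = L} inverse (M⊑K G∈M) ∈ simplices (pullback M)
    gG∈pullback G∈M = inverse-simplicial (M⊑K G∈M) ,
      downward M G∈M (image-inverse-image (M⊑K G∈M) (inverse-simplicial (M⊑K G∈M)))

    g : Func (V M) (V (pullback M))
    g .to (w , G , G∈M , w∈G) = _ , _ , gG∈pullback G∈M , (w , w∈G , refl)
    g .Func.cong = Func.cong inverse

    f-simplicial : IsSimplicial {L = pullback M} {K = M} f
    -- The images of `F` under `f` and under `map` are definitionally equal, so the stored
    -- membership is the goal.
    f-simplicial (F∈L , fF∈M) = fF∈M

    g-simplicial : IsSimplicial {L = M} {K = pullback M} g
    g-simplicial = gG∈pullback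

  -- A simplex `F` of `L` lies in the pullback of whichever member contains f(F), so the number `k`
  -- of members is preserved. `P` and `Q` stay abstract to serve both complexities.
  CoveredBy-pullback : {P : Pred (SimplicialComplex {ℓ} W) _} {Q : Pred (SimplicialComplex {ℓ} U) _} →
                       (∀ {M N} → N ≅ M → P M → Q N) → ∀ {k} → CoveredBy P K k → CoveredBy Q L k
  CoveredBy-pullback P⇒Q (Ks , Ks⊑K , (K⊆⋃ , _) , PKs) =
    (λ i → pullback (Ks i)) ,
    (λ i → proj₁) ,
    ((λ F∈L → let i , fF∈Kᵢ = K⊆⋃ (map-simplicial F∈L) in i , F∈L , fF∈Kᵢ) , λ (_ , F∈L , _) → F∈L) ,
    (λ i → P⇒Q (pullback-≅ (Ks i) (Ks⊑K i)) (PKs i))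

FacetCovered-resp-≅ : {L : SimplicialComplex {ℓ} U} {L′ : SimplicialComplex {ℓ} U′}
                      {H : SimplicialComplex {ℓ} W} {H′ : SimplicialComplex {ℓ} W′} → L′ ≅ L → H′ ≅ H →
                      CoveredBy (λ Lᵢ → FacetMap Lᵢ H) L ⊆ CoveredBy (λ Lᵢ → FacetMap Lᵢ H′) L′
FacetCovered-resp-≅ {H = H} {H′} L′≅L H′≅H = CoveredBy-pullback L′≅L λ {M} {N} N≅M f →
  FacetMap-trans N M H′ (≅⇒FacetMap N≅M) (FacetMap-trans M H H′ f (≅⇒FacetMap (≅-sym H′≅H)))

InjectiveFacetCovered-resp-≅ : {L : SimplicialComplex {ℓ} U} {L′ : SimplicialComplex {ℓ} U′}
                               {H : SimplicialComplex {ℓ} W} {H′ : SimplicialComplex {ℓ} W′} → L′ ≅ L → H′ ≅ H →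
                               CoveredBy (λ Lᵢ → InjectiveFacetMap Lᵢ H) L ⊆
                               CoveredBy (λ Lᵢ → InjectiveFacetMap Lᵢ H′) L′
InjectiveFacetCovered-resp-≅ {H = H} {H′} L′≅L H′≅H = CoveredBy-pullback L′≅L λ {M} {N} N≅M f →
  InjectiveFacetMap-trans N M H′ (≅⇒InjectiveFacetMap N≅M)
    (InjectiveFacetMap-trans M H H′ f (≅⇒InjectiveFacetMap (≅-sym H′≅H)))

-- P ⊆ Q transports attainment of the minimum; Q ⊆ P turns any competitor for `Q` into one for `P`,
-- which gives minimality and also the infinite case.
LeastPositive-resp-≐ : {P Q : Pred ℕ p} → P ≐ Q → ∀ c → LeastPositive P c → LeastPositive Q c
LeastPositive-resp-≐ (P⊆Q , Q⊆P) [ k ] (0<k , Pk , least) = 0<k , P⊆Q Pk , λ 0<j Qj → least 0<j (Q⊆P Qj)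
LeastPositive-resp-≐ (P⊆Q , Q⊆P) ⊤⁺    none               = λ 0<k Qk → none 0<k (Q⊆P Qk)

LeastPositive-⇔ : {P Q : Pred ℕ p} → P ⊆ Q → Q ⊆ P → ∀ c → LeastPositive P c ⇔ LeastPositive Q c
LeastPositive-⇔ P⊆Q Q⊆P c =
  mk⇔ (LeastPositive-resp-≐ (P⊆Q , Q⊆P) c) (LeastPositive-resp-≐ (Q⊆P , P⊆Q) c)

corollary3p9 : ∀ {ℓ : Level} {U U′ W W′ : Set ℓ}
    (L : SimplicialComplex U) (L′ : SimplicialComplex U′)
    (H : SimplicialComplex W) (H′ : SimplicialComplex W′) →
    L′ ≅ L → H′ ≅ H →
    (∀ (c : ℕ ⁺) → (C[ L ﹔ H ]= c) ⇔ (C[ L′ ﹔ H′ ]= c)) ×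
    (∀ (c : ℕ ⁺) → (IC[ L ﹔ H ]= c) ⇔ (IC[ L′ ﹔ H′ ]= c))
corollary3p9 L L′ H H′ L′≅L H′≅H =
  -- The reverse inclusion is the same lemma applied to the inverse isomorphisms.
  LeastPositive-⇔ (FacetCovered-resp-≅ L′≅L H′≅H)
                  (FacetCovered-resp-≅ (≅-sym L′≅L) (≅-sym H′≅H)) ,
  LeastPositive-⇔ (InjectiveFacetCovered-resp-≅ L′≅L H′≅H)
                  (InjectiveFacetCovered-resp-≅ (≅-sym L′≅L) (≅-sym H′≅H))
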